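{- For every nonnegative integer $n$, $$pod(n)=\sum_{j=0}^{\infty}q_{odd}(j)\,p\!\left(\frac n2-\frac j2\right),$$ where $p(x)=0$ if $x$ is not an integer.
   Context: $pod(n)$ denotes the number of partitions of $n$ in which odd parts are distinct and even parts may be repeated; $q_{odd}(n)$ denotes the number of partitions of $n$ into distinct odd parts; $p(n)$ denotes the number of (unrestricted) partitions of $n$. Each takes the value $1$ at $0$, and $p(x)=0$ if $x$ is negative. -}

module Defs where

open import Data.Integer.Base using (+_; -[1+_])
open import Data.List.Base
  using (List; []; _∷_; _++_; map; filter; length; upTo)
open import Data.List.Membership.Propositional using (_∈_)
open import Data.List.Membership.Propositional.Properties
  using (∈-map⁺; ∈-map⁻; ∈-++⁺ˡ; ∈-++⁺ʳ; ∈-++⁻; ∈-filter⁺; ∈-filter⁻)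
open import Data.List.Properties using (∷-injectiveʳ)
open import Data.List.Relation.Unary.All using (All; []; _∷_; all?)
open import Data.List.Relation.Unary.Any using (here)
open import Data.List.Relation.Unary.AllPairs using ([]; _∷_)
open import Data.List.Relation.Unary.Linked using (Linked; linked?)
open import Data.List.Relation.Unary.Unique.Propositional using (Unique)
import Data.List.Relation.Unary.Unique.Propositional.Properties as Unique
open import Data.Nat.Base using (ℕ; zero; suc; _+_; _≤_; _<_; _≥_)
open import Data.Nat.Divisibility using (_∤_; _∣?_)
open import Data.Nat.ListAction using (sum)
open import Data.Nat.Properties
  using (_≟_; _<?_; _≥?_; ≤-refl; ≤-trans; n≤1+n; <-irrefl; +-suc; +-identityʳ;
         +-cancelˡ-≡; m≤n⇒m<n∨m≡n; 1+n≰n; m≤m+n)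
open import Data.List.Relation.Unary.Unique.DecPropositional _≟_ using (unique?)
open import Data.Product.Base using (∃-syntax; _×_; _,_; proj₂)
open import Data.Rational.Base using (ℚ; mkℚ)
open import Data.Sum.Base using (inj₁; inj₂)
open import Function.Bundles using (_⇔_; mk⇔)
open import Relation.Binary.PropositionalEquality
  using (_≡_; refl; trans; subst)
open import Relation.Nullary.Decidable using (¬?; _×-dec_)
open import Relation.Nullary.Negation using (contradiction)
open import Relation.Unary using (Decidable)

-- A partition is written as the list of its parts in weakly decreasing order.
IsPartition : ℕ → List ℕ → Set
IsPartition n xs = All (0 <_) xs × Linked _≥_ xs × sum xs ≡ n

isPartition? : ∀ n → Decidable (IsPartition n)
isPartition? n xs = all? (0 <?_) xs ×-dec linked? _≥?_ xs ×-dec (sum xs ≟ n)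

-- The compositions (lists of positive parts) of k + n whose first part is at
-- least k, for k positive.
compositionsFrom : ℕ → ℕ → List (List ℕ)
compositionsFrom k zero    = (k ∷ []) ∷ []
compositionsFrom k (suc n) =
  map (k ∷_) (compositionsFrom 1 n) ++ compositionsFrom (suc k) n

compositions : ℕ → List (List ℕ)
compositions zero    = [] ∷ []
compositions (suc n) = compositionsFrom 1 n

-- ∈-partitions and partitions-unique below show that this list contains every
-- partition of n exactly once, so that lengths of its filters are genuine
-- counts of partitions.
partitions : ℕ → List (List ℕ)
partitions n = filter (isPartition? n) (compositions n)

Odd : ℕ → Set
Odd n = 2 ∤ n

odd? : Decidable Odd
odd? n = ¬? (2 ∣? n)

OddPartsDistinct : List ℕ → Set
OddPartsDistinct xs = Unique (filter odd? xs)

oddPartsDistinct? : Decidable OddPartsDistinct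
oddPartsDistinct? xs = unique? (filter odd? xs)

DistinctOdd : List ℕ → Set
DistinctOdd xs = Unique xs × All Odd xs

distinctOdd? : Decidable DistinctOdd
distinctOdd? xs = unique? xs ×-dec all? odd? xs

p : ℕ → ℕ
p n = length (partitions n)

pod : ℕ → ℕ
pod n = length (filter oddPartsDistinct? (partitions n))

q-odd : ℕ → ℕ
q-odd n = length (filter distinctOdd? (partitions n))

-- p extended by zero to the rationals that are negative or not integers.
-- Elements of ℚ are in lowest terms and the second field of mkℚ is the
-- denominator minus one, so mkℚ (+ n) 0 _ is the integer n.
pℚ : ℚ → ℕ
pℚ (mkℚ (+ n)    zero    _) = p n
pℚ (mkℚ (+ _)    (suc _) _) = 0
pℚ (mkℚ -[1+ _ ] _       _) = 0

-- f 0 + f 1 + f 2 + ⋯ = s.  As ℕ is discrete, a series converges to s exactly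
-- when its partial sums are eventually equal to s.
HasSum : (ℕ → ℕ) → ℕ → Set
HasSum f s = ∃[ N ] (∀ M → N ≤ M → sum (map f (upTo M)) ≡ s)

private
  ∈-compositionsFrom⁻ : ∀ k n {xs} → xs ∈ compositionsFrom k n →
                        ∃[ h ] ∃[ t ] (xs ≡ h ∷ t × k ≤ h)
  ∈-compositionsFrom⁻ k zero    (here refl) = k , [] , refl , ≤-refl
  ∈-compositionsFrom⁻ k (suc n) xs∈
    with ∈-++⁻ (map (k ∷_) (compositionsFrom 1 n)) xs∈
  ... | inj₁ xs∈ˡ with t , _ , refl ← ∈-map⁻ (k ∷_) xs∈ˡ = k , t , refl , ≤-refl
  ... | inj₂ xs∈ʳ with h , t , eq , k<h ← ∈-compositionsFrom⁻ (suc k) n xs∈ʳ =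
    h , t , eq , ≤-trans (n≤1+n k) k<h

  compositionsFrom-unique : ∀ k n → Unique (compositionsFrom k n)
  compositionsFrom-unique k zero    = [] ∷ []
  compositionsFrom-unique k (suc n) =
    Unique.++⁺ (Unique.map⁺ ∷-injectiveʳ (compositionsFrom-unique 1 n))
               (compositionsFrom-unique (suc k) n)
               disjoint
    where
    disjoint : ∀ {xs} → xs ∈ map (k ∷_) (compositionsFrom 1 n) ×
               xs ∈ compositionsFrom (suc k) n → _
    disjoint (xs∈ˡ , xs∈ʳ)
      with _ , _ , refl ← ∈-map⁻ (k ∷_) xs∈ˡ
      with _ , _ , refl , k<k ← ∈-compositionsFrom⁻ (suc k) n xs∈ʳ = <-irrefl refl k<k

  ∈-compositionsFrom⁺ : ∀ k n {h t} → k ≤ h → All (0 <_) t → h + sum t ≡ k + n →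
                        (h ∷ t) ∈ compositionsFrom k n
  ∈-compositionsFrom⁺ k n k≤h t>0 eq with m≤n⇒m<n∨m≡n k≤h
  ∈-compositionsFrom⁺ k zero {h} {t} k≤h t>0 eq | inj₁ k<h =
    contradiction
      (≤-trans k<h (subst (h ≤_) (trans eq (+-identityʳ k)) (m≤m+n h (sum t))))
      1+n≰n
  ∈-compositionsFrom⁺ k (suc n) k≤h t>0 eq | inj₁ k<h =
    ∈-++⁺ʳ (map (k ∷_) (compositionsFrom 1 n))
      (∈-compositionsFrom⁺ (suc k) n k<h t>0 (trans eq (+-suc k n)))
  ∈-compositionsFrom⁺ k zero {t = []} k≤h t>0 eq | inj₂ refl = here refl
  ∈-compositionsFrom⁺ k (suc n) {t = []} k≤h t>0 eq | inj₂ refl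
    with () ← +-cancelˡ-≡ k 0 (suc n) eq
  ∈-compositionsFrom⁺ k zero {t = suc x ∷ t} k≤h t>0 eq | inj₂ refl
    with () ← +-cancelˡ-≡ k (suc x + sum t) 0 eq
  ∈-compositionsFrom⁺ k (suc n) {t = x ∷ t} k≤h (x>0 ∷ t>0) eq | inj₂ refl =
    ∈-++⁺ˡ (∈-map⁺ (k ∷_)
      (∈-compositionsFrom⁺ 1 n x>0 t>0 (+-cancelˡ-≡ k (x + sum t) (suc n) eq)))
  ∈-compositionsFrom⁺ k zero {t = zero ∷ t} k≤h (() ∷ _) eq | inj₂ refl

  ∈-compositions⁺ : ∀ n {xs} → All (0 <_) xs → sum xs ≡ n → xs ∈ compositions n
  ∈-compositions⁺ zero    {[]}         _           _  = here refl
  ∈-compositions⁺ zero    {zero  ∷ _}  (() ∷ _)    _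
  ∈-compositions⁺ (suc n) {x ∷ _}      (x>0 ∷ t>0) eq = ∈-compositionsFrom⁺ 1 n x>0 t>0 eq

compositions-unique : ∀ n → Unique (compositions n)
compositions-unique zero    = [] ∷ []
compositions-unique (suc n) = compositionsFrom-unique 1 n

∈-partitions : ∀ n xs → xs ∈ partitions n ⇔ IsPartition n xs
∈-partitions n xs = mk⇔
  (λ xs∈ → proj₂ (∈-filter⁻ (isPartition? n) {xs = compositions n} xs∈))
  (λ { part@(pos , _ , eq) → ∈-filter⁺ (isPartition? n) (∈-compositions⁺ n pos eq) part })

partitions-unique : ∀ n → Unique (partitions n)
partitions-unique n = Unique.filter⁺ (isPartition? n) (compositions-unique n)

{-# OPTIONS --safe #-}

-- Splitting a partition of n into its odd parts and its halved even parts is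
-- inverted by doubling, appending and sorting.  It is thus a bijection from the
-- partitions of n with distinct odd parts to the pairs of a partition of some j
-- into distinct odd parts and a partition of (n - j)/2.
module Submission where

open import Defs
open import Data.Nat.Base using (ℕ; _*_)
open import Data.Integer.Base using (+_)
open import Data.Rational.Base using (_/_; _-_)

open import Data.Integer.Base as ℤ using (-[1+_])
import Data.Integer.Properties as ℤ
open import Data.Integer.Tactic.RingSolver using (solve-∀)
open import Data.List.Base
  using (List; []; _∷_; _++_; map; concatMap; cartesianProduct; filter; length; upTo)
open import Data.List.Membership.Propositional using (_∈_; find; lose)
open import Data.List.Membership.Propositional.Properties
  using (∈-map⁺; ∈-map⁻; ∈-filter⁺; ∈-filter⁻; ∈-cartesianProduct⁺; ∈-cartesianProduct⁻;
         ∈-concatMap⁺; ∈-concatMap⁻; ∈-upTo⁺)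
open import Data.List.Membership.Propositional.Properties.WithK using (unique∧set⇒bag)
open import Data.List.Properties
  using (length-++; length-map; map-cong; map-∘; map-id-local; filter-++; filter-all; filter-none;
         ++-identityʳ; partition-defn)
open import Data.List.Relation.Binary.BagAndSetEquality using (∼bag⇒↭)
open import Data.List.Relation.Binary.Disjoint.Propositional using (Disjoint)
open import Data.List.Relation.Binary.Permutation.Propositional
  using (_↭_; ↭-sym; ↭⇒↭ₛ; ↭ₛ⇒↭; module PermutationReasoning)
open import Data.List.Relation.Binary.Permutation.Propositional.Properties
  using (↭-length; filter-↭; All-resp-↭)
import Data.List.Relation.Binary.Permutation.Setoid.Properties as Permutationₛ
open import Data.List.Relation.Binary.Pointwise using (Pointwise-≡⇒≡)
open import Data.List.Relation.Unary.All as All using (All)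
import Data.List.Relation.Unary.All.Properties as All
import Data.List.Relation.Unary.AllPairs as AllPairs
import Data.List.Relation.Unary.AllPairs.Properties as AllPairs
open import Data.List.Relation.Unary.Linked as Linked using (Linked)
import Data.List.Relation.Unary.Linked.Properties as Linked
open import Data.List.Relation.Unary.Sorted.TotalOrder.Properties using (↗↭↗⇒≋)
open import Data.List.Relation.Unary.Unique.Propositional using (Unique)
import Data.List.Relation.Unary.Unique.Propositional.Properties as Unique
open import Data.Nat.Base as ℕ using (zero; suc; _+_; _≤_; _<_; _≥_; s≤s)
open import Data.Nat.Divisibility using (_∣_; _∣?_; n∣m*n; ∣⇒≤)
import Data.Nat.DivMod as ℕ
open import Data.Nat.ListAction using (sum)
open import Data.Nat.ListAction.Properties using (sum-++; sum-↭)
open import Data.Nat.Properties as ℕ using (≤-decTotalOrder)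
open import Data.Product.Base using (_×_; _,_; proj₁; proj₂)
open import Data.Rational.Base as ℚ using (ℚ; mkℚ; toℚᵘ)
open import Data.Rational.Literals using (fromℤ)
import Data.Rational.Properties as ℚ
open import Data.Rational.Unnormalised.Base as ℚᵘ using (mkℚᵘ; *≡*; _≃_)
import Data.Rational.Unnormalised.Properties as ℚᵘ
open import Function.Base using (_∘_; flip)
open import Function.Bundles using (_⇔_; mk⇔; Equivalence)
open import Relation.Binary.Bundles using (DecTotalOrder)
import Relation.Binary.Construct.Flip.EqAndOrd as Flip
open import Relation.Binary.PropositionalEquality
  using (_≡_; _≢_; refl; sym; trans; cong; cong₂; subst; setoid; module ≡-Reasoning)
open import Relation.Nullary.Negation using (contradiction)
open import Relation.Unary using (Decidable)
open import Relation.Unary.Properties using (∁?)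

-- The order is flipped so that `sort` returns weakly decreasing lists, the form that `IsPartition`
-- demands.
≥-decTotalOrder : DecTotalOrder _ _ _
≥-decTotalOrder = Flip.decTotalOrder ≤-decTotalOrder

open import Data.List.Sort ≥-decTotalOrder using (sort; sort-↭; sort-↗)

-- Lengths, sums and rearrangements of lists.

length-concatMap : ∀ {A B : Set} (f : A → List B) xs →
                   length (concatMap f xs) ≡ sum (map (length ∘ f) xs)
length-concatMap f []       = refl
length-concatMap f (x ∷ xs) =
  trans (length-++ (f x)) (cong (λ m → length (f x) + m) (length-concatMap f xs))

length-cartesianProduct : ∀ {A B : Set} (xs : List A) (ys : List B) →
                          length (cartesianProduct xs ys) ≡ length xs * length ys
length-cartesianProduct []       ys = refl
length-cartesianProduct (x ∷ xs) ys =
  trans (length-++ (map (x ,_) ys))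
        (cong₂ _+_ (length-map (x ,_) ys) (length-cartesianProduct xs ys))

sum-map-* : ∀ m xs → sum (map (_* m) xs) ≡ sum xs * m
sum-map-* m []       = refl
sum-map-* m (x ∷ xs) =
  trans (cong (λ s → x * m + s) (sum-map-* m xs)) (sym (ℕ.*-distribʳ-+ m x (sum xs)))

filter-↭-++ : ∀ {A : Set} {P : A → Set} (P? : Decidable P) xs →
              xs ↭ filter P? xs ++ filter (∁? P?) xs
filter-↭-++ P? xs =
  subst (λ (ys , zs) → xs ↭ ys ++ zs) (partition-defn P? xs)
        (↭ₛ⇒↭ (Permutationₛ.partition-↭ (setoid _) P? xs))

-- A multiset has only one weakly decreasing arrangement. Equality of partitions thus reduces to a
-- permutation, and the order in which parts are assembled can be ignored.
≥-sorted-↭⇒≡ : ∀ {xs ys} → Linked _≥_ xs → Linked _≥_ ys → xs ↭ ys → xs ≡ ys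
≥-sorted-↭⇒≡ xs↘ ys↘ xs↭ys =
  Pointwise-≡⇒≡ (↗↭↗⇒≋ (DecTotalOrder.totalOrder ≥-decTotalOrder) xs↘ ys↘ (↭⇒↭ₛ xs↭ys))

filter-≥-sorted : ∀ {P : ℕ → Set} (P? : Decidable P) {xs} →
                  Linked _≥_ xs → Linked _≥_ (filter P? xs)
filter-≥-sorted P? = Linked.filter⁺ P? (flip ℕ.≤-trans)

-- Splitting off the odd parts, and its inverse.

half : ℕ → ℕ
half n = n ℕ./ 2

even? : Decidable (2 ∣_)
even? = 2 ∣?_

split : List ℕ → List ℕ × List ℕ
split xs = filter odd? xs , map half (filter even? xs)

join : List ℕ × List ℕ → List ℕ
join (os , es) = sort (map (_* 2) es ++ os)

double-half : ∀ {xs} → All (2 ∣_) xs → map (_* 2) (map half xs) ≡ xs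
double-half evens =
  trans (sym (map-∘ _)) (map-id-local (All.map ℕ.m/n*n≡m evens))

half-double : ∀ xs → map half (map (_* 2) xs) ≡ xs
half-double xs =
  trans (sym (map-∘ xs)) (map-id-local (All.universal (λ m → ℕ.m*n/n≡m m 2) xs))

double-even : ∀ xs → All (2 ∣_) (map (_* 2) xs)
double-even xs = All.map⁺ (All.universal (λ m → n∣m*n m) xs)

join-split : ∀ {xs} → Linked _≥_ xs → join (split xs) ≡ xs
join-split {xs} xs↘ = ≥-sorted-↭⇒≡ (sort-↗ _) xs↘ (begin
  join (split xs)
    ↭⟨ sort-↭ _ ⟩
  map (_* 2) (map half (filter even? xs)) ++ filter odd? xs
    ≡⟨ cong (_++ filter odd? xs) (double-half (All.all-filter even? xs)) ⟩
  filter even? xs ++ filter odd? xs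
    -- `odd?` and `∁? even?` unfold to the same decision procedure.
    ↭⟨ filter-↭-++ even? xs ⟨
  xs ∎)
  where open PermutationReasoning

-- Filtering commutes with sorting up to permutation. Before sorting, the doubled parts are all even
-- and `os` is all odd, so each filter keeps exactly one of the two blocks.
split-join : ∀ {os es} → All Odd os → Linked _≥_ os → Linked _≥_ es →
             split (join (os , es)) ≡ (os , es)
split-join {os} {es} odds os↘ es↘ =
  cong₂ _,_ odd-parts (trans (cong (map half) even-parts) (half-double es))
  where
  open PermutationReasoning
  unsorted = map (_* 2) es ++ os

  odd-parts : filter odd? (join (os , es)) ≡ os
  odd-parts = ≥-sorted-↭⇒≡ (filter-≥-sorted odd? (sort-↗ unsorted)) os↘ (begin
    filter odd? (sort unsorted)
      ↭⟨ filter-↭ odd? (sort-↭ unsorted) ⟩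
    filter odd? unsorted
      ≡⟨ filter-++ odd? (map (_* 2) es) os ⟩
    filter odd? (map (_* 2) es) ++ filter odd? os
      -- `Odd` is a negation, so `contradiction` turns evenness into a refutation of oddness.
      ≡⟨ cong₂ _++_ (filter-none odd? (All.map contradiction (double-even es)))
                    (filter-all odd? odds) ⟩
    os ∎)

  even-parts : filter even? (join (os , es)) ≡ map (_* 2) es
  even-parts = ≥-sorted-↭⇒≡
    (filter-≥-sorted even? (sort-↗ unsorted))
    (Linked.map⁺ (Linked.map (ℕ.*-monoˡ-≤ 2) es↘))
    (begin
    filter even? (sort unsorted)
      ↭⟨ filter-↭ even? (sort-↭ unsorted) ⟩
    filter even? unsorted
      ≡⟨ filter-++ even? (map (_* 2) es) os ⟩
    filter even? (map (_* 2) es) ++ filter even? os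
      ≡⟨ cong₂ _++_ (filter-all even? (double-even es)) (filter-none even? odds) ⟩
    map (_* 2) es ++ []
      ≡⟨ ++-identityʳ _ ⟩
    map (_* 2) es ∎)

sum-join : ∀ os es → sum (join (os , es)) ≡ sum es * 2 + sum os
sum-join os es = begin
  sum (sort (map (_* 2) es ++ os)) ≡⟨ sum-↭ (sort-↭ (map (_* 2) es ++ os)) ⟩
  sum (map (_* 2) es ++ os)        ≡⟨ sum-++ (map (_* 2) es) os ⟩
  sum (map (_* 2) es) + sum os     ≡⟨ cong (_+ sum os) (sum-map-* 2 es) ⟩
  sum es * 2 + sum os              ∎
  where open ≡-Reasoning

join-positive : ∀ {os es} → All (0 <_) os → All (0 <_) es → All (0 <_) (join (os , es))
join-positive {os} {es} os>0 es>0 =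
  All-resp-↭ (↭-sym (sort-↭ (map (_* 2) es ++ os)))
    (All.++⁺ (All.map⁺ (All.map (λ { (s≤s _) → ℕ.z<s }) es>0)) os>0)

-- A positive multiple of 2 is at least 2, so its half does not round down to 0.
half-positive : ∀ {n} → 0 < n → 2 ∣ n → 0 < half n
half-positive {suc _} _ 2∣n = ℕ.m≥n⇒m/n>0 (∣⇒≤ 2∣n)

halves-positive : ∀ {xs} → All (0 <_) xs → All (0 <_) (map half (filter even? xs))
halves-positive {xs} xs>0 =
  All.map⁺ (All.zipWith (λ (n>0 , 2∣n) → half-positive n>0 2∣n)
                        (All.filter⁺ even? xs>0 , All.all-filter even? xs))

halves-≥-sorted : ∀ {xs} → Linked _≥_ xs → Linked _≥_ (map half (filter even? xs))
halves-≥-sorted xs↘ =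
  Linked.map⁺ (Linked.map (ℕ./-monoˡ-≤ 2) (filter-≥-sorted even? xs↘))

-- Partitions of the rational argument `n / 2 - j / 2`.

partitionsℚ : ℚ → List (List ℕ)
partitionsℚ (mkℚ (+ n)    zero    _) = partitions n
partitionsℚ (mkℚ (+ _)    (suc _) _) = []
partitionsℚ (mkℚ -[1+ _ ] _       _) = []

length-partitionsℚ : ∀ q → length (partitionsℚ q) ≡ pℚ q
length-partitionsℚ (mkℚ (+ n)    zero    _) = refl
length-partitionsℚ (mkℚ (+ _)    (suc _) _) = refl
length-partitionsℚ (mkℚ -[1+ _ ] _       _) = refl

partitionsℚ-unique : ∀ q → Unique (partitionsℚ q)
partitionsℚ-unique (mkℚ (+ n)    zero    _) = partitions-unique n
partitionsℚ-unique (mkℚ (+ _)    (suc _) _) = AllPairs.[]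
partitionsℚ-unique (mkℚ -[1+ _ ] _       _) = AllPairs.[]

-- Only the integer case lists anything. Recording it as an equation in ℚ replaces the case
-- distinction on `mkℚ` by arithmetic.
∈-partitionsℚ⁻ : ∀ q {xs} → xs ∈ partitionsℚ q →
                 All (0 <_) xs × Linked _≥_ xs × q ≡ fromℤ (+ sum xs)
∈-partitionsℚ⁻ (mkℚ (+ n) zero _) {xs} xs∈
  -- The last `refl` identifies two rationals that differ only in their irrelevant coprimality
  -- proofs.
  with xs>0 , xs↘ , refl ← Equivalence.to (∈-partitions n xs) xs∈ = xs>0 , xs↘ , refl

∈-partitionsℚ⁺ : ∀ {q xs} → All (0 <_) xs → Linked _≥_ xs → q ≡ fromℤ (+ sum xs) →
                 xs ∈ partitionsℚ q
∈-partitionsℚ⁺ {xs = xs} xs>0 xs↘ refl =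
  Equivalence.from (∈-partitions (sum xs) xs) (xs>0 , xs↘ , refl)

-- In ℚ the fractions are reduced by a gcd, which does not compute for variable numerators.
-- Unnormalised fractions keep the denominator 2, so their difference has an explicit numerator over
-- 4.
toℚᵘ-half-difference : ∀ i j → toℚᵘ (i / 2 - j / 2) ≃ mkℚᵘ i 1 ℚᵘ.- mkℚᵘ j 1
toℚᵘ-half-difference i j = begin
  toℚᵘ (i / 2 - j / 2)
    ≈⟨ ℚ.toℚᵘ-homo-+ (i / 2) (ℚ.- (j / 2)) ⟩
  toℚᵘ (i / 2) ℚᵘ.+ toℚᵘ (ℚ.- (j / 2))
    ≈⟨ ℚᵘ.+-cong (ℚ.toℚᵘ-fromℚᵘ (mkℚᵘ i 1))
         (ℚᵘ.≃-trans (ℚ.toℚᵘ-homo‿- (j / 2)) (ℚᵘ.-‿cong (ℚ.toℚᵘ-fromℚᵘ (mkℚᵘ j 1)))) ⟩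
  mkℚᵘ i 1 ℚᵘ.- mkℚᵘ j 1 ∎
  where open ℚᵘ.≃-Reasoning

half-difference≡⇒ : ∀ i j k → i / 2 - j / 2 ≡ fromℤ k → k ℤ.* + 2 ℤ.+ j ≡ i
half-difference≡⇒ i j k eq
  -- Cross-multiplying a fraction over 4 with `k` over 1 gives `eq′`. Its factor 4 is why the goal
  -- is doubled before 2 is cancelled.
  with *≡* eq′ ← ℚᵘ.≃-trans (ℚᵘ.≃-sym (toℚᵘ-half-difference i j)) (ℚ.toℚᵘ-cong eq) =
  ℤ.*-cancelʳ-≡ _ _ (+ 2) (begin
    (k ℤ.* + 2 ℤ.+ j) ℤ.* + 2
      ≡⟨ lhs j k ⟩
    k ℤ.* + 4 ℤ.+ j ℤ.* + 2
      ≡⟨ cong (ℤ._+ j ℤ.* + 2) eq′ ⟨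
    (i ℤ.* + 2 ℤ.+ (ℤ.- j) ℤ.* + 2) ℤ.* + 1 ℤ.+ j ℤ.* + 2
      ≡⟨ rhs i j ⟩
    i ℤ.* + 2 ∎)
  where
  open ≡-Reasoning
  lhs : ∀ j k → (k ℤ.* + 2 ℤ.+ j) ℤ.* + 2 ≡ k ℤ.* + 4 ℤ.+ j ℤ.* + 2
  lhs = solve-∀
  rhs : ∀ i j → (i ℤ.* + 2 ℤ.+ (ℤ.- j) ℤ.* + 2) ℤ.* + 1 ℤ.+ j ℤ.* + 2 ≡ i ℤ.* + 2
  rhs = solve-∀

half-difference≡⇐ : ∀ j k → (k ℤ.* + 2 ℤ.+ j) / 2 - j / 2 ≡ fromℤ k
half-difference≡⇐ j k = ℚ.toℚᵘ-injective
  (ℚᵘ.≃-trans (toℚᵘ-half-difference (k ℤ.* + 2 ℤ.+ j) j) (*≡* (cross-multiplied j k)))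
  where
  cross-multiplied : ∀ j k →
    ((k ℤ.* + 2 ℤ.+ j) ℤ.* + 2 ℤ.+ (ℤ.- j) ℤ.* + 2) ℤ.* + 1 ≡ k ℤ.* + 4
  cross-multiplied = solve-∀

pos-*-+ : ∀ m o j → + (m * o + j) ≡ + m ℤ.* + o ℤ.+ + j
pos-*-+ m o j = trans (ℤ.pos-+ (m * o) j) (cong (ℤ._+ + j) (ℤ.pos-* m o))

-- The subtraction-free equation in ℕ expresses at once that `n - j` is even and that it is
-- nonnegative.
half-difference⇔ : ∀ n j m → + n / 2 - + j / 2 ≡ fromℤ (+ m) ⇔ m * 2 + j ≡ n
half-difference⇔ n j m = mk⇔
  (λ eq → ℤ.+-injective (trans (pos-*-+ m 2 j) (half-difference≡⇒ (+ n) (+ j) (+ m) eq)))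
  (λ { refl → trans (cong (λ i → i / 2 - + j / 2) (pos-*-+ m 2 j))
                    (half-difference≡⇐ (+ j) (+ m)) })

-- Counting the pairs and summing the series.

podPartitions : ℕ → List (List ℕ)
podPartitions n = filter oddPartsDistinct? (partitions n)

oddPartitions : ℕ → List (List ℕ)
oddPartitions j = filter distinctOdd? (partitions j)

module _ (n : ℕ) where

  pairsAt : ℕ → List (List ℕ × List ℕ)
  pairsAt j = cartesianProduct (oddPartitions j) (partitionsℚ (+ n / 2 - + j / 2))

  -- The set counted by the partial sum of the first `M` terms of the series.
  pairsBelow : ℕ → List (List ℕ × List ℕ)
  pairsBelow M = concatMap pairsAt (upTo M)

  length-pairsBelow : ∀ M → length (pairsBelow M) ≡
                      sum (map (λ j → q-odd j * pℚ (+ n / 2 - + j / 2)) (upTo M))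
  length-pairsBelow M = trans (length-concatMap pairsAt (upTo M))
    (cong sum (map-cong (λ j →
      trans (length-cartesianProduct (oddPartitions j) _)
            (cong (q-odd j *_) (length-partitionsℚ (+ n / 2 - + j / 2)))) (upTo M)))

  ∈-pairsAt⁻ : ∀ j {os es} → (os , es) ∈ pairsAt j →
    (IsPartition j os × DistinctOdd os) ×
    (All (0 <_) es × Linked _≥_ es × sum es * 2 + j ≡ n)
  ∈-pairsAt⁻ j {os} {es} ∈at =
    let os∈ , es∈        = ∈-cartesianProduct⁻ (oddPartitions j) _ ∈at
        os∈ₚ , distinct  = ∈-filter⁻ distinctOdd? {xs = partitions j} os∈
        es>0 , es↘ , eq = ∈-partitionsℚ⁻ (+ n / 2 - + j / 2) es∈
    in (Equivalence.to (∈-partitions j os) os∈ₚ , distinct)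
     , es>0 , es↘ , Equivalence.to (half-difference⇔ n j (sum es)) eq

  ∈-pairsAt⁺ : ∀ j {os es} → IsPartition j os → DistinctOdd os →
    All (0 <_) es → Linked _≥_ es → sum es * 2 + j ≡ n → (os , es) ∈ pairsAt j
  ∈-pairsAt⁺ j {os} {es} partition distinct es>0 es↘ eq = ∈-cartesianProduct⁺
    (∈-filter⁺ distinctOdd? (Equivalence.from (∈-partitions j os) partition) distinct)
    (∈-partitionsℚ⁺ es>0 es↘ (Equivalence.from (half-difference⇔ n j (sum es)) eq))

  -- The index of a pair can be recovered as the sum of its first component.
  pairsAt-disjoint : ∀ {i j} → i ≢ j → Disjoint (pairsAt i) (pairsAt j)
  pairsAt-disjoint i≢j (∈i , ∈j) =
    let ((_ , _ , sum≡i) , _) , _ = ∈-pairsAt⁻ _ ∈i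
        ((_ , _ , sum≡j) , _) , _ = ∈-pairsAt⁻ _ ∈j
    in i≢j (trans (sym sum≡i) sum≡j)

  pairsBelow-unique : ∀ M → Unique (pairsBelow M)
  pairsBelow-unique M = Unique.concat⁺
    (All.map⁺ (All.universal
      (λ j → Unique.cartesianProduct⁺
               (Unique.filter⁺ distinctOdd? (partitions-unique j))
               (partitionsℚ-unique (+ n / 2 - + j / 2)))
      (upTo M)))
    (AllPairs.map⁺ (AllPairs.map (λ i≢j {_} → pairsAt-disjoint i≢j) (Unique.upTo⁺ M)))

  ∈-podPartitions⁻ : ∀ {xs} → xs ∈ podPartitions n → IsPartition n xs × OddPartsDistinct xs
  ∈-podPartitions⁻ {xs} xs∈ =
    let xs∈ₚ , distinct = ∈-filter⁻ oddPartsDistinct? {xs = partitions n} xs∈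
    in Equivalence.to (∈-partitions n xs) xs∈ₚ , distinct

  join∘split-podPartitions : map join (map split (podPartitions n)) ≡ podPartitions n
  join∘split-podPartitions = trans (sym (map-∘ (podPartitions n)))
    (map-id-local (All.tabulate λ xs∈ →
      let (_ , xs↘ , _) , _ = ∈-podPartitions⁻ xs∈ in join-split xs↘))

  -- `split` is injective only up to the order of parts, so the left inverse is used instead: a
  -- repetition here would survive `map join`, which gives back the duplicate-free
  -- `podPartitions n`.
  split-podPartitions-unique : Unique (map split (podPartitions n))
  split-podPartitions-unique = Unique.map⁻ (subst Unique (sym join∘split-podPartitions)
    (Unique.filter⁺ oddPartsDistinct? (partitions-unique n)))

  ∈-split⇔∈-pairsBelow : ∀ {M} → n < M → ∀ {ps} →
                         ps ∈ map split (podPartitions n) ⇔ ps ∈ pairsBelow M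
  ∈-split⇔∈-pairsBelow {M} n<M = mk⇔ to from
    where
    to : ∀ {ps} → ps ∈ map split (podPartitions n) → ps ∈ pairsBelow M
    to ps∈
      with xs , xs∈ , refl ← ∈-map⁻ split ps∈
      with (xs>0 , xs↘ , sum≡n) , distinct ← ∈-podPartitions⁻ xs∈ =
      -- The index is the sum `j` of the odd parts; it is at most `n`, hence below `M`.
      ∈-concatMap⁺ pairsAt (lose (∈-upTo⁺ (ℕ.≤-<-trans j≤n n<M))
        (∈-pairsAt⁺ j
          (All.filter⁺ odd? xs>0 , filter-≥-sorted odd? xs↘ , refl)
          (distinct , All.all-filter odd? xs)
          (halves-positive xs>0) (halves-≥-sorted xs↘) total))
      where
      os = proj₁ (split xs)
      es = proj₂ (split xs)
      j  = sum os

      total : sum es * 2 + j ≡ n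
      total = trans (sym (sum-join os es)) (trans (cong sum (join-split xs↘)) sum≡n)

      j≤n : j ≤ n
      j≤n = subst (j ≤_) total (ℕ.m≤n+m j (sum es * 2))

    from : ∀ {ps} → ps ∈ pairsBelow M → ps ∈ map split (podPartitions n)
    from {os , es} ps∈
      with j , _ , ∈at ← find (∈-concatMap⁻ pairsAt {xs = upTo M} ps∈)
      with ((os>0 , os↘ , refl) , unique , odds) , es>0 , es↘ , total ← ∈-pairsAt⁻ j ∈at =
      subst (_∈ map split (podPartitions n)) split∘join
        (∈-map⁺ split (∈-filter⁺ oddPartsDistinct?
          (Equivalence.from (∈-partitions n (join (os , es)))
            (join-positive os>0 es>0 , sort-↗ _ , trans (sum-join os es) total))
          -- The odd parts of the joined partition are `os` again, so their distinctness carries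
          -- over.
          (subst Unique (sym (cong proj₁ split∘join)) unique)))
      where
      split∘join : split (join (os , es)) ≡ (os , es)
      split∘join = split-join odds os↘ es↘

  -- Two duplicate-free lists with the same members are permutations of each other, so they have
  -- equal length.
  length-pairsBelow≡pod : ∀ {M} → n < M → length (pairsBelow M) ≡ pod n
  length-pairsBelow≡pod {M} n<M = trans
    (sym (↭-length (∼bag⇒↭ (unique∧set⇒bag
      split-podPartitions-unique (pairsBelow-unique M) (∈-split⇔∈-pairsBelow n<M)))))
    (length-map split (podPartitions n))

theorem4p2 : (n : ℕ) → HasSum (λ j → q-odd j * pℚ ((+ n / 2) - (+ j / 2))) (pod n)
-- The bound is `suc n` because `upTo M` must still contain the index `j = n`; `suc n ≤ M` is
-- `n < M` by definition.
theorem4p2 n = suc n , λ M n<M →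
  trans (sym (length-pairsBelow n M)) (length-pairsBelow≡pod n n<M)
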